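{- Let $\mathbf A = \langle A, \to, 0\rangle$ be an implication zroupoid. Then the bisemigroup $\mathbf A_{mj} = \langle A, \wedge, \vee\rangle$ satisfies the Birkhoff identity: for all $x, y \in A$, $$x \wedge (x \vee y) = x \vee (x \wedge y).$$
   Context: An implication zroupoid is an algebra $\mathbf A = \langle A, \to, 0\rangle$, where $\to$ is a binary operation and $0$ is a constant, such that, writing $x' := x \to 0$ (and $x'' := (x')'$), the following hold for all $x,y,z\in A$: (1) $(x \to y) \to z = [(z' \to x) \to (y \to z)']'$, and (2) $0'' = 0$. For an implication zroupoid $\mathbf A$, define on $A$ the operations $x \wedge y := (x \to y')'$ and $x \vee y := (x' \wedge y')'$, and put $\mathbf A_{mj} := \langle A, \wedge, \vee\rangle$. A bisemigroup is an algebra with two associative binary operations; it is a known result that $\mathbf A_{mj}$ is a bisemigroup for every implication zroupoid $\mathbf A$. -}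

module Defs where

open import Level using (suc; _⊔_)
open import Algebra.Core using (Op₁; Op₂)
open import Algebra.Structures using (IsMagma)
open import Algebra.Lattice.Bundles.Raw using (RawLattice)
open import Relation.Binary.Core using (Rel)

-- Algebras are over setoids, as in Algebra.Bundles: the equality of the
-- algebra is _≈_, and IsMagma says that it is an equivalence relation
-- respected by _⇒_.
record ImplicationZroupoid c ℓ : Set (suc (c ⊔ ℓ)) where
  infix  9 _′
  infixr 6 _⇒_
  infix  4 _≈_
  field
    Carrier : Set c
    _≈_     : Rel Carrier ℓ
    _⇒_     : Op₂ Carrier
    0#      : Carrier

  _′ : Op₁ Carrier
  x ′ = x ⇒ 0#

  field
    ⇒-isMagma : IsMagma _≈_ _⇒_
    ⇒-law     : ∀ x y z → (x ⇒ y) ⇒ z ≈ ((z ′ ⇒ x) ⇒ (y ⇒ z) ′) ′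
    0″≈0      : (0# ′) ′ ≈ 0#

  open IsMagma ⇒-isMagma public

  infixr 7 _∧_
  infixr 6 _∨_

  _∧_ : Op₂ Carrier
  x ∧ y = (x ⇒ y ′) ′

  _∨_ : Op₂ Carrier
  x ∨ y = (x ′ ∧ y ′) ′

-- RawLattice is a carrier with an equality and two binary operations; it
-- imposes no laws, so associativity of _∧_ and _∨_ is neither assumed nor
-- asserted here.
mj : ∀ {c ℓ} → ImplicationZroupoid c ℓ → RawLattice c ℓ
mj A = record { Carrier = Carrier ; _≈_ = _≈_ ; _∧_ = _∧_ ; _∨_ = _∨_ }
  where open ImplicationZroupoid A

BirkhoffIdentity : ∀ {c ℓ} → RawLattice c ℓ → Set (c ⊔ ℓ)
BirkhoffIdentity L = ∀ x y → (x ∧ (x ∨ y)) ≈ (x ∨ (x ∧ y))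
  where open RawLattice L

{-# OPTIONS --safe #-}

-- Write x ~ y for x ″ ≈ y ″.  The law lets one replace an argument in any of
-- the three positions of (x ⇒ y) ⇒ z by a ~-related one, so ~ is a congruence,
-- and x ″ ~ x.  Modulo ~ the operations ∧, ∨ are De Morgan duals of each other,
-- and with ⊥ = 0 and ⊤ = 0′ the law becomes the dual pair
--   (x ∨ y) ∧ z = (z ∧ x) ∨ (y ∧ z),   (x ∧ y) ∨ z = (z ∨ x) ∧ (y ∨ z).
-- These two identities and the right units ⊤, ⊥ already imply Birkhoff's
-- identity, without any use of associativity.  Finally both sides of Birkhoff's
-- identity in A are fixed by ″, so that ~ between them is ≈.
module Submission where

open import Defs
open import Level using (suc; _⊔_)
open import Algebra.Core using (Op₂)
open import Algebra.Structures using (IsMagma)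
open import Relation.Binary.Core using (Rel)
open import Relation.Binary.Structures using (IsEquivalence)
import Relation.Binary.Reasoning.Setoid as SetoidReasoning

-- Cross-distributive algebras and their duality.

record CrossDistributive c ℓ : Set (suc (c ⊔ ℓ)) where
  infixr 7 _∧_
  infixr 6 _∨_
  infix  4 _≈_
  field
    Carrier     : Set c
    _≈_         : Rel Carrier ℓ
    _∧_         : Op₂ Carrier
    _∨_         : Op₂ Carrier
    ⊤           : Carrier
    ⊥           : Carrier
    ∧-isMagma   : IsMagma _≈_ _∧_
    ∨-isMagma   : IsMagma _≈_ _∨_
    ∧-identityʳ : ∀ x → x ∧ ⊤ ≈ x
    ∨-identityʳ : ∀ x → x ∨ ⊥ ≈ x
    ∧-cross-∨   : ∀ x y z → (x ∨ y) ∧ z ≈ z ∧ x ∨ y ∧ z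
    ∨-cross-∧   : ∀ x y z → (x ∧ y) ∨ z ≈ (z ∨ x) ∧ (y ∨ z)

  open IsMagma ∧-isMagma public
    using (isEquivalence; refl; sym; trans; setoid)
    renaming (∙-cong to ∧-cong; ∙-congˡ to ∧-congˡ; ∙-congʳ to ∧-congʳ)
  open IsMagma ∨-isMagma public
    using ()
    renaming (∙-cong to ∨-cong; ∙-congˡ to ∨-congˡ; ∙-congʳ to ∨-congʳ)

-- The axioms come in dual pairs, so every lemma below also holds with `∧`, `∨` and `⊤`, `⊥`
-- exchanged; the local modules `Dual` supply these versions.
dual : ∀ {c ℓ} → CrossDistributive c ℓ → CrossDistributive c ℓ
dual S = record
  { _∧_         = _∨_
  ; _∨_         = _∧_
  ; ⊤           = ⊥
  ; ⊥           = ⊤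
  ; ∧-isMagma   = ∨-isMagma
  ; ∨-isMagma   = ∧-isMagma
  ; ∧-identityʳ = ∨-identityʳ
  ; ∨-identityʳ = ∧-identityʳ
  ; ∧-cross-∨   = ∨-cross-∧
  ; ∨-cross-∧   = ∧-cross-∨
  } where open CrossDistributive S

-- Units, idempotence and weak absorption.

module LeftUnit {c ℓ} (S : CrossDistributive c ℓ) where
  open CrossDistributive S
  open SetoidReasoning setoid

  ∧-identityˡ : ∀ x → ⊤ ∧ x ≈ x
  ∧-identityˡ x = begin
    ⊤ ∧ x          ≈⟨ ∨-identityʳ _ ⟨
    ⊤ ∧ x ∨ ⊥      ≈⟨ ∨-congˡ (∧-identityʳ ⊥) ⟨
    ⊤ ∧ x ∨ ⊥ ∧ ⊤  ≈⟨ ∧-cross-∨ x ⊥ ⊤ ⟨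
    (x ∨ ⊥) ∧ ⊤    ≈⟨ ∧-identityʳ _ ⟩
    x ∨ ⊥          ≈⟨ ∨-identityʳ x ⟩
    x              ∎

  -- Commuting two factors costs an error term `⊥ ∧ y` that depends on the right factor only.
  ∧-swap : ∀ x y → x ∧ y ≈ y ∧ x ∨ ⊥ ∧ y
  ∧-swap x y = begin
    x ∧ y          ≈⟨ ∧-congʳ (∨-identityʳ x) ⟨
    (x ∨ ⊥) ∧ y    ≈⟨ ∧-cross-∨ x ⊥ y ⟩
    y ∧ x ∨ ⊥ ∧ y  ∎

module Idempotence {c ℓ} (S : CrossDistributive c ℓ) where
  open CrossDistributive S
  open LeftUnit S public
  private module Dual = LeftUnit (dual S)
  open SetoidReasoning setoid

  ⊥∧⊥≈⊥ : ⊥ ∧ ⊥ ≈ ⊥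
  ⊥∧⊥≈⊥ = begin
    ⊥ ∧ ⊥          ≈⟨ Dual.∧-identityˡ _ ⟨
    ⊥ ∨ ⊥ ∧ ⊥      ≈⟨ ∨-congʳ (∧-identityʳ ⊥) ⟨
    ⊥ ∧ ⊤ ∨ ⊥ ∧ ⊥  ≈⟨ ∧-swap ⊤ ⊥ ⟨
    ⊤ ∧ ⊥          ≈⟨ ∧-identityˡ ⊥ ⟩
    ⊥              ∎

  -- For right factor `⊥` the error term of `∧-swap` is `⊥ ∧ ⊥ ≈ ⊥`, which `∨` ignores.
  ⊥-central : ∀ x → x ∧ ⊥ ≈ ⊥ ∧ x
  ⊥-central x = begin
    x ∧ ⊥          ≈⟨ ∧-swap x ⊥ ⟩
    ⊥ ∧ x ∨ ⊥ ∧ ⊥  ≈⟨ ∨-congˡ ⊥∧⊥≈⊥ ⟩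
    ⊥ ∧ x ∨ ⊥      ≈⟨ ∨-identityʳ _ ⟩
    ⊥ ∧ x          ∎

  ⊥∧-distrib-∨ : ∀ x y → ⊥ ∧ (x ∨ y) ≈ ⊥ ∧ x ∨ ⊥ ∧ y
  ⊥∧-distrib-∨ x y = begin
    ⊥ ∧ (x ∨ y)    ≈⟨ ⊥-central _ ⟨
    (x ∨ y) ∧ ⊥    ≈⟨ ∧-cross-∨ x y ⊥ ⟩
    ⊥ ∧ x ∨ y ∧ ⊥  ≈⟨ ∨-congˡ (⊥-central y) ⟩
    ⊥ ∧ x ∨ ⊥ ∧ y  ∎

  ⊥∧[⊤∨x]≈⊥∧x : ∀ x → ⊥ ∧ (⊤ ∨ x) ≈ ⊥ ∧ x
  ⊥∧[⊤∨x]≈⊥∧x x = begin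
    ⊥ ∧ (⊤ ∨ x)    ≈⟨ ⊥∧-distrib-∨ ⊤ x ⟩
    ⊥ ∧ ⊤ ∨ ⊥ ∧ x  ≈⟨ ∨-congʳ (∧-identityʳ ⊥) ⟩
    ⊥ ∨ ⊥ ∧ x      ≈⟨ Dual.∧-identityˡ _ ⟩
    ⊥ ∧ x          ∎

  -- The form `⊥ ∧ y ∨ x` serves as a normal form: several absorption-like terms reduce to it and
  -- can then be exchanged.
  x∧[y∨x]≈⊥∧y∨x : ∀ x y → x ∧ (y ∨ x) ≈ ⊥ ∧ y ∨ x
  x∧[y∨x]≈⊥∧y∨x x y = begin
    x ∧ (y ∨ x)        ≈⟨ ∧-congʳ (∨-identityʳ x) ⟨
    (x ∨ ⊥) ∧ (y ∨ x)  ≈⟨ ∨-cross-∧ ⊥ y x ⟨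
    ⊥ ∧ y ∨ x          ∎

  [x∨y]∧x≈⊥∧y∨x : ∀ x y → (x ∨ y) ∧ x ≈ ⊥ ∧ y ∨ x
  [x∨y]∧x≈⊥∧y∨x x y = begin
    (x ∨ y) ∧ x        ≈⟨ ∧-congˡ (Dual.∧-identityˡ x) ⟨
    (x ∨ y) ∧ (⊥ ∨ x)  ≈⟨ ∨-cross-∧ y ⊥ x ⟨
    y ∧ ⊥ ∨ x          ≈⟨ ∨-congʳ (⊥-central y) ⟩
    ⊥ ∧ y ∨ x          ∎

  ∧-idem : ∀ x → x ∧ x ≈ x
  ∧-idem x = begin
    x ∧ x        ≈⟨ ∧-congˡ (Dual.∧-identityˡ x) ⟨
    x ∧ (⊥ ∨ x)  ≈⟨ x∧[y∨x]≈⊥∧y∨x x ⊥ ⟩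
    ⊥ ∧ ⊥ ∨ x    ≈⟨ ∨-congʳ ⊥∧⊥≈⊥ ⟩
    ⊥ ∨ x        ≈⟨ Dual.∧-identityˡ x ⟩
    x            ∎

module Absorption {c ℓ} (S : CrossDistributive c ℓ) where
  open CrossDistributive S
  open Idempotence S public
  private module Dual = Idempotence (dual S)
  open SetoidReasoning setoid

  x∨y∧x≈⊥∧y∨x : ∀ x y → x ∨ y ∧ x ≈ ⊥ ∧ y ∨ x
  x∨y∧x≈⊥∧y∨x x y = begin
    x ∨ y ∧ x      ≈⟨ ∨-congʳ (∧-idem x) ⟨
    x ∧ x ∨ y ∧ x  ≈⟨ ∧-cross-∨ x y x ⟨
    (x ∨ y) ∧ x    ≈⟨ [x∨y]∧x≈⊥∧y∨x x y ⟩
    ⊥ ∧ y ∨ x      ∎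

  -- The normal form is self-dual: `x ∨ y ∧ x` reduces to it directly, and to its dual by the dual
  -- of `x∧[y∨x]≈⊥∧y∨x`.
  [⊤∨y]∧x≈⊥∧y∨x : ∀ x y → (⊤ ∨ y) ∧ x ≈ ⊥ ∧ y ∨ x
  [⊤∨y]∧x≈⊥∧y∨x x y = begin
    (⊤ ∨ y) ∧ x  ≈⟨ Dual.x∧[y∨x]≈⊥∧y∨x x y ⟨
    x ∨ y ∧ x    ≈⟨ x∨y∧x≈⊥∧y∨x x y ⟩
    ⊥ ∧ y ∨ x    ∎

  x∧y∨x≈⊥∧y∨x : ∀ x y → x ∧ y ∨ x ≈ ⊥ ∧ y ∨ x
  x∧y∨x≈⊥∧y∨x x y = begin
    x ∧ y ∨ x          ≈⟨ ∨-cross-∧ x y x ⟩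
    (x ∨ x) ∧ (y ∨ x)  ≈⟨ ∧-congʳ (Dual.∧-idem x) ⟩
    x ∧ (y ∨ x)        ≈⟨ x∧[y∨x]≈⊥∧y∨x x y ⟩
    ⊥ ∧ y ∨ x          ∎

  ⊥∧[⊥∧x]≈⊥∧x : ∀ x → ⊥ ∧ (⊥ ∧ x) ≈ ⊥ ∧ x
  ⊥∧[⊥∧x]≈⊥∧x x = begin
    ⊥ ∧ (⊥ ∧ x)        ≈⟨ ⊥∧[⊤∨x]≈⊥∧x _ ⟨
    ⊥ ∧ (⊤ ∨ ⊥ ∧ x)    ≈⟨ ∧-congˡ (Dual.⊥∧[⊤∨x]≈⊥∧x x) ⟩
    ⊥ ∧ (⊤ ∨ x)        ≈⟨ ⊥∧[⊤∨x]≈⊥∧x x ⟩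
    ⊥ ∧ x              ∎

  [⊤∨y]∧⊥∧y≈⊥∧y : ∀ y → (⊤ ∨ y) ∧ ⊥ ∧ y ≈ ⊥ ∧ y
  [⊤∨y]∧⊥∧y≈⊥∧y y = begin
    (⊤ ∨ y) ∧ ⊥ ∧ y  ≈⟨ [⊤∨y]∧x≈⊥∧y∨x (⊥ ∧ y) y ⟩
    ⊥ ∧ y ∨ ⊥ ∧ y    ≈⟨ Dual.∧-idem _ ⟩
    ⊥ ∧ y            ∎

  [⊥∧y]∧[⊤∨y]≈⊥∧y : ∀ y → (⊥ ∧ y) ∧ (⊤ ∨ y) ≈ ⊥ ∧ y
  [⊥∧y]∧[⊤∨y]≈⊥∧y y = begin
    (⊥ ∧ y) ∧ (⊤ ∨ y)                ≈⟨ ∧-swap (⊥ ∧ y) (⊤ ∨ y) ⟩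
    (⊤ ∨ y) ∧ ⊥ ∧ y ∨ ⊥ ∧ (⊤ ∨ y)    ≈⟨ ∨-cong ([⊤∨y]∧⊥∧y≈⊥∧y y) (⊥∧[⊤∨x]≈⊥∧x y) ⟩
    ⊥ ∧ y ∨ ⊥ ∧ y                    ≈⟨ Dual.∧-idem _ ⟩
    ⊥ ∧ y                            ∎

  x∨[⊤∨y]∧x≈[⊤∨y]∧x : ∀ x y → x ∨ (⊤ ∨ y) ∧ x ≈ (⊤ ∨ y) ∧ x
  x∨[⊤∨y]∧x≈[⊤∨y]∧x x y = begin
    x ∨ (⊤ ∨ y) ∧ x    ≈⟨ x∨y∧x≈⊥∧y∨x x (⊤ ∨ y) ⟩
    ⊥ ∧ (⊤ ∨ y) ∨ x    ≈⟨ ∨-congʳ (⊥∧[⊤∨x]≈⊥∧x y) ⟩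
    ⊥ ∧ y ∨ x          ≈⟨ [⊤∨y]∧x≈⊥∧y∨x x y ⟨
    (⊤ ∨ y) ∧ x        ∎

  x∧[⊤∨y]∨x≈[⊤∨y]∧x : ∀ x y → x ∧ (⊤ ∨ y) ∨ x ≈ (⊤ ∨ y) ∧ x
  x∧[⊤∨y]∨x≈[⊤∨y]∧x x y = begin
    x ∧ (⊤ ∨ y) ∨ x    ≈⟨ x∧y∨x≈⊥∧y∨x x (⊤ ∨ y) ⟩
    ⊥ ∧ (⊤ ∨ y) ∨ x    ≈⟨ ∨-congʳ (⊥∧[⊤∨x]≈⊥∧x y) ⟩
    ⊥ ∧ y ∨ x          ≈⟨ [⊤∨y]∧x≈⊥∧y∨x x y ⟨
    (⊤ ∨ y) ∧ x        ∎

  x∧[⊤∨y]≈[⊤∨y]∧x∨⊥∧y : ∀ x y → x ∧ (⊤ ∨ y) ≈ (⊤ ∨ y) ∧ x ∨ ⊥ ∧ y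
  x∧[⊤∨y]≈[⊤∨y]∧x∨⊥∧y x y = begin
    x ∧ (⊤ ∨ y)                  ≈⟨ ∧-swap x (⊤ ∨ y) ⟩
    (⊤ ∨ y) ∧ x ∨ ⊥ ∧ (⊤ ∨ y)    ≈⟨ ∨-congˡ (⊥∧[⊤∨x]≈⊥∧x y) ⟩
    (⊤ ∨ y) ∧ x ∨ ⊥ ∧ y          ∎

-- Birkhoff's identity from cross-distributivity.

module Birkhoff {c ℓ} (S : CrossDistributive c ℓ) where
  open CrossDistributive S
  open Absorption S
  private module Dual = Absorption (dual S)
  open SetoidReasoning setoid

  x∨⊥∧y≈[⊤∨y]∧x∧[⊤∨y] : ∀ x y → x ∨ ⊥ ∧ y ≈ (⊤ ∨ y) ∧ (x ∧ (⊤ ∨ y))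
  x∨⊥∧y≈[⊤∨y]∧x∧[⊤∨y] x y = begin
    x ∨ ⊥ ∧ y                            ≈⟨ Dual.x∧[⊤∨y]≈[⊤∨y]∧x∨⊥∧y x y ⟩
    (⊥ ∧ y ∨ x) ∧ (⊤ ∨ y)                ≈⟨ ∧-cross-∨ (⊥ ∧ y) x (⊤ ∨ y) ⟩
    (⊤ ∨ y) ∧ ⊥ ∧ y ∨ x ∧ (⊤ ∨ y)        ≈⟨ ∨-congʳ ([⊤∨y]∧⊥∧y≈⊥∧y y) ⟩
    ⊥ ∧ y ∨ x ∧ (⊤ ∨ y)                  ≈⟨ [⊤∨y]∧x≈⊥∧y∨x (x ∧ (⊤ ∨ y)) y ⟨
    (⊤ ∨ y) ∧ (x ∧ (⊤ ∨ y))              ∎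

  x∧[⊤∨y]≈[⊤∨y]∧[x∨⊥∧y] : ∀ x y → x ∧ (⊤ ∨ y) ≈ (⊤ ∨ y) ∧ (x ∨ ⊥ ∧ y)
  x∧[⊤∨y]≈[⊤∨y]∧[x∨⊥∧y] x y = begin
    x ∧ (⊤ ∨ y)                          ≈⟨ x∧[⊤∨y]≈[⊤∨y]∧x∨⊥∧y x y ⟩
    (⊤ ∨ y) ∧ x ∨ ⊥ ∧ y                  ≈⟨ ∨-cross-∧ (⊤ ∨ y) x (⊥ ∧ y) ⟩
    (⊥ ∧ y ∨ ⊤ ∨ y) ∧ (x ∨ ⊥ ∧ y)        ≈⟨ ∧-congʳ (Dual.[⊤∨y]∧⊥∧y≈⊥∧y y) ⟩
    (⊤ ∨ y) ∧ (x ∨ ⊥ ∧ y)                ∎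

  [x∨⊥∧y]∧[⊤∨y]≈x∧[⊤∨y] : ∀ x y → (x ∨ ⊥ ∧ y) ∧ (⊤ ∨ y) ≈ x ∧ (⊤ ∨ y)
  [x∨⊥∧y]∧[⊤∨y]≈x∧[⊤∨y] x y = begin
    (x ∨ ⊥ ∧ y) ∧ (⊤ ∨ y)                ≈⟨ ∧-cross-∨ x (⊥ ∧ y) (⊤ ∨ y) ⟩
    (⊤ ∨ y) ∧ x ∨ (⊥ ∧ y) ∧ (⊤ ∨ y)      ≈⟨ ∨-congˡ ([⊥∧y]∧[⊤∨y]≈⊥∧y y) ⟩
    (⊤ ∨ y) ∧ x ∨ ⊥ ∧ y                  ≈⟨ x∧[⊤∨y]≈[⊤∨y]∧x∨⊥∧y x y ⟨
    x ∧ (⊤ ∨ y)                          ∎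

  -- The mirror image of `[⊤∨y]∧x≈⊥∧y∨x`. With `t = ⊤ ∨ y`, the three preceding lemmas say
  -- `p ≈ t ∧ q`, `q ≈ t ∧ p` and `p ∧ t ≈ q`; weak absorption then forces `p ≈ q`.
  x∧[⊤∨y]≈x∨⊥∧y : ∀ x y → x ∧ (⊤ ∨ y) ≈ x ∨ ⊥ ∧ y
  x∧[⊤∨y]≈x∨⊥∧y x y = begin
    q                        ≈⟨ x∧[⊤∨y]≈[⊤∨y]∧[x∨⊥∧y] x y ⟩
    (⊤ ∨ y) ∧ p              ≈⟨ x∧[⊤∨y]∨x≈[⊤∨y]∧x p y ⟨
    p ∧ (⊤ ∨ y) ∨ p          ≈⟨ ∨-cong ([x∨⊥∧y]∧[⊤∨y]≈x∧[⊤∨y] x y) (x∨⊥∧y≈[⊤∨y]∧x∧[⊤∨y] x y) ⟩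
    q ∨ (⊤ ∨ y) ∧ q          ≈⟨ x∨[⊤∨y]∧x≈[⊤∨y]∧x q y ⟩
    (⊤ ∨ y) ∧ q              ≈⟨ x∨⊥∧y≈[⊤∨y]∧x∧[⊤∨y] x y ⟨
    p                        ∎
    where
    p = x ∨ ⊥ ∧ y
    q = x ∧ (⊤ ∨ y)

  -- Under `⊥ ∧_` a prefix `⊤ ∨_` is invisible, and `⊤ ∨_` distributes over `∧`. This matches the
  -- error terms of the two sides of Birkhoff's identity.
  ⊥∧[x∧y]≈⊥∧[x∨y] : ∀ x y → ⊥ ∧ (x ∧ y) ≈ ⊥ ∧ (x ∨ y)
  ⊥∧[x∧y]≈⊥∧[x∨y] x y = begin
    ⊥ ∧ (x ∧ y)                ≈⟨ ⊥∧[⊤∨x]≈⊥∧x _ ⟨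
    ⊥ ∧ (⊤ ∨ x ∧ y)            ≈⟨ ∧-congˡ (Dual.⊥∧-distrib-∨ x y) ⟩
    ⊥ ∧ ((⊤ ∨ x) ∧ (⊤ ∨ y))    ≈⟨ ∧-congˡ ([⊤∨y]∧x≈⊥∧y∨x (⊤ ∨ y) x) ⟩
    ⊥ ∧ (⊥ ∧ x ∨ ⊤ ∨ y)        ≈⟨ ⊥∧-distrib-∨ (⊥ ∧ x) (⊤ ∨ y) ⟩
    ⊥ ∧ ⊥ ∧ x ∨ ⊥ ∧ (⊤ ∨ y)    ≈⟨ ∨-cong (⊥∧[⊥∧x]≈⊥∧x x) (⊥∧[⊤∨x]≈⊥∧x y) ⟩
    ⊥ ∧ x ∨ ⊥ ∧ y              ≈⟨ ⊥∧-distrib-∨ x y ⟨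
    ⊥ ∧ (x ∨ y)                ∎

  birkhoff : ∀ x y → x ∧ (x ∨ y) ≈ x ∨ (x ∧ y)
  birkhoff x y = begin
    x ∧ (x ∨ y)                      ≈⟨ ∧-swap x (x ∨ y) ⟩
    (x ∨ y) ∧ x ∨ ⊥ ∧ (x ∨ y)        ≈⟨ ∨-congʳ ([x∨y]∧x≈⊥∧y∨x x y) ⟩
    -- The normal form is now read as that of `x ∧ y ∨ x`, so that `x ∧ y` appears in both terms.
    (⊥ ∧ y ∨ x) ∨ ⊥ ∧ (x ∨ y)        ≈⟨ ∨-cong (x∧y∨x≈⊥∧y∨x x y) (⊥∧[x∧y]≈⊥∧[x∨y] x y) ⟨
    -- The additive error term becomes the multiplicative one of the dual swap.
    (x ∧ y ∨ x) ∨ ⊥ ∧ (x ∧ y)        ≈⟨ x∧[⊤∨y]≈x∨⊥∧y (x ∧ y ∨ x) (x ∧ y) ⟨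
    (x ∧ y ∨ x) ∧ (⊤ ∨ x ∧ y)        ≈⟨ Dual.∧-swap x (x ∧ y) ⟨
    x ∨ x ∧ y                        ∎

-- The congruence `_~_` and its quotient.

module DoublePrime {c ℓ} (A : ImplicationZroupoid c ℓ) where
  open ImplicationZroupoid A
  open SetoidReasoning setoid

  infix 4 _~_

  _~_ : Rel Carrier ℓ
  x ~ y = x ′ ′ ≈ y ′ ′

  ′-cong : ∀ {x y} → x ≈ y → x ′ ≈ y ′
  ′-cong = ∙-congʳ

  ≈⇒~ : ∀ {x y} → x ≈ y → x ~ y
  ≈⇒~ x≈y = ′-cong (′-cong x≈y)

  0′⇒x~x : ∀ x → 0# ′ ⇒ x ~ x
  0′⇒x~x x = begin
    (0# ′ ⇒ x) ′ ′               ≈⟨ ′-cong (∙-congˡ 0″≈0) ⟨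
    ((0# ′ ⇒ x) ⇒ (0# ′) ′) ′    ≈⟨ ⇒-law x 0# 0# ⟨
    x ′ ′                        ∎

  -- At `z = 0#` the right side of the law contains `y` only through `y ′ ′`.
  [x⇒_]′-cong : ∀ x {y z} → y ~ z → (x ⇒ y) ′ ≈ (x ⇒ z) ′
  [x⇒_]′-cong x {y} {z} y~z = begin
    (x ⇒ y) ′                  ≈⟨ ⇒-law x y 0# ⟩
    ((0# ′ ⇒ x) ⇒ y ′ ′) ′     ≈⟨ ′-cong (∙-congˡ y~z) ⟩
    ((0# ′ ⇒ x) ⇒ z ′ ′) ′     ≈⟨ ⇒-law x z 0# ⟨
    (x ⇒ z) ′                  ∎

  [x⇒y]⇒_′-cong : ∀ x y {z w} → z ~ w → (x ⇒ y) ⇒ z ′ ≈ (x ⇒ y) ⇒ w ′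
  [x⇒y]⇒_′-cong x y {z} {w} z~w = begin
    (x ⇒ y) ⇒ z ′                        ≈⟨ ⇒-law x y (z ′) ⟩
    ((z ′ ′ ⇒ x) ⇒ (y ⇒ z ′) ′) ′        ≈⟨ ′-cong (∙-cong (∙-congʳ z~w) ([x⇒_]′-cong y (′-cong z~w))) ⟩
    ((w ′ ′ ⇒ x) ⇒ (y ⇒ w ′) ′) ′        ≈⟨ ⇒-law x y (w ′) ⟨
    (x ⇒ y) ⇒ w ′                        ∎

  -- The law moves `x ′` behind `z ′`, which is itself an implication, so the previous lemma
  -- applies.
  [_′⇒y]⇒z-cong : ∀ y z {x w} → x ~ w → (x ′ ⇒ y) ⇒ z ≈ (w ′ ⇒ y) ⇒ z
  [_′⇒y]⇒z-cong y z {x} {w} x~w = begin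
    (x ′ ⇒ y) ⇒ z                  ≈⟨ ⇒-law (x ′) y z ⟩
    ((z ′ ⇒ x ′) ⇒ (y ⇒ z) ′) ′    ≈⟨ ′-cong (∙-congʳ ([x⇒y]⇒_′-cong z 0# x~w)) ⟩
    ((z ′ ⇒ w ′) ⇒ (y ⇒ z) ′) ′    ≈⟨ ⇒-law (w ′) y z ⟨
    (w ′ ⇒ y) ⇒ z                  ∎

  [x⇒y]⇒_-cong : ∀ x y {z w} → z ~ w → (x ⇒ y) ⇒ z ≈ (x ⇒ y) ⇒ w
  [x⇒y]⇒_-cong x y {z} {w} z~w = begin
    (x ⇒ y) ⇒ z                  ≈⟨ ⇒-law x y z ⟩
    ((z ′ ⇒ x) ⇒ (y ⇒ z) ′) ′    ≈⟨ ′-cong ([_′⇒y]⇒z-cong x _ z~w) ⟩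
    ((w ′ ⇒ x) ⇒ (y ⇒ z) ′) ′    ≈⟨ ′-cong (∙-congˡ ([x⇒_]′-cong y z~w)) ⟩
    ((w ′ ⇒ x) ⇒ (y ⇒ w) ′) ′    ≈⟨ ⇒-law x y w ⟨
    (x ⇒ y) ⇒ w                  ∎

  [_⇒y]⇒z-cong : ∀ y z {x w} → x ~ w → (x ⇒ y) ⇒ z ≈ (w ⇒ y) ⇒ z
  [_⇒y]⇒z-cong y z {x} {w} x~w = begin
    (x ⇒ y) ⇒ z                  ≈⟨ ⇒-law x y z ⟩
    ((z ′ ⇒ x) ⇒ (y ⇒ z) ′) ′    ≈⟨ ′-cong (∙-congʳ ([x⇒y]⇒_-cong z 0# x~w)) ⟩
    ((z ′ ⇒ w) ⇒ (y ⇒ z) ′) ′    ≈⟨ ⇒-law w y z ⟨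
    (w ⇒ y) ⇒ z                  ∎

  [x⇒y″]′≈[x⇒y]′ : ∀ x y → (x ⇒ y ′ ′) ′ ≈ (x ⇒ y) ′
  [x⇒y″]′≈[x⇒y]′ x y = begin
    (x ⇒ y ′ ′) ′              ≈⟨ [_⇒y]⇒z-cong (y ′ ′) 0# (0′⇒x~x x) ⟨
    ((0# ′ ⇒ x) ⇒ y ′ ′) ′     ≈⟨ ⇒-law x y 0# ⟨
    (x ⇒ y) ′                  ∎

  x″~x : ∀ x → x ′ ′ ~ x
  x″~x x = begin
    (x ′ ′) ′ ′                ≈⟨ 0′⇒x~x (x ′ ′) ⟨
    (0# ′ ⇒ x ′ ′) ′ ′         ≈⟨ ′-cong ([x⇒y″]′≈[x⇒y]′ (0# ′) x) ⟩
    (0# ′ ⇒ x) ′ ′             ≈⟨ 0′⇒x~x x ⟩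
    x ′ ′                      ∎

  -- The law turns (0′ ⇒ x) ⇒ y into w′, and w, whose premise is again an
  -- implication, into z′; so (x ⇒ y)′ is a triple prime and x″~x applies.
  [x⇒y]‴≈[x⇒y]′ : ∀ x y → ((x ⇒ y) ′) ′ ′ ≈ (x ⇒ y) ′
  [x⇒y]‴≈[x⇒y]′ x y = begin
    ((x ⇒ y) ′) ′ ′    ≈⟨ ≈⇒~ [x⇒y]′≈z‴ ⟩
    (z ′ ′ ′) ′ ′      ≈⟨ ′-cong (x″~x z) ⟩
    z ′ ′ ′            ≈⟨ [x⇒y]′≈z‴ ⟨
    (x ⇒ y) ′          ∎
    where
    v = (x ⇒ y) ′
    z = (v ′ ⇒ y ′) ⇒ (0# ′ ⇒ v) ′
    [x⇒y]′≈z‴ : (x ⇒ y) ′ ≈ z ′ ′ ′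
    [x⇒y]′≈z‴ = begin
      (x ⇒ y) ′                     ≈⟨ [_⇒y]⇒z-cong y 0# (0′⇒x~x x) ⟨
      ((0# ′ ⇒ x) ⇒ y) ′            ≈⟨ ′-cong (⇒-law (0# ′) x y) ⟩
      ((y ′ ⇒ 0# ′) ⇒ v) ′ ′        ≈⟨ ≈⇒~ (⇒-law (y ′) (0# ′) v) ⟩
      z ′ ′ ′                       ∎

  ~-isEquivalence : IsEquivalence _~_
  ~-isEquivalence = record { refl = refl ; sym = sym ; trans = trans }

  ~-⇒-isMagma : IsMagma _~_ _⇒_
  ~-⇒-isMagma = record
    { isEquivalence = ~-isEquivalence
    ; ∙-cong = λ {x} {y} {u} {v} x~y u~v →
        ′-cong (trans ([_⇒y]⇒z-cong u 0# x~y) ([x⇒_]′-cong y u~v))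
    }

  -- Only the equality is coarsened, so an identity in the quotient is one between double primes in
  -- `A`.
  /~ : ImplicationZroupoid c ℓ
  /~ = record
    { ⇒-isMagma = ~-⇒-isMagma
    ; ⇒-law     = λ x y z → ≈⇒~ (⇒-law x y z)
    ; 0″≈0      = ≈⇒~ 0″≈0
    }

-- Involutive zroupoids as cross-distributive algebras.

IsInvolutive : ∀ {c ℓ} → ImplicationZroupoid c ℓ → Set (c ⊔ ℓ)
IsInvolutive A = ∀ x → x ′ ′ ≈ x
  where open ImplicationZroupoid A

module Involutive {c ℓ} (A : ImplicationZroupoid c ℓ) (″-involutive : IsInvolutive A) where
  open ImplicationZroupoid A
  open SetoidReasoning setoid

  ′-cong : ∀ {x y} → x ≈ y → x ′ ≈ y ′
  ′-cong = ∙-congʳ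

  ∧-cong : ∀ {x y u v} → x ≈ y → u ≈ v → x ∧ u ≈ y ∧ v
  ∧-cong x≈y u≈v = ′-cong (∙-cong x≈y (′-cong u≈v))

  x∨y≈x′⇒y : ∀ x y → x ∨ y ≈ x ′ ⇒ y
  x∨y≈x′⇒y x y = trans (″-involutive _) (∙-congˡ (″-involutive y))

  [x∧y]′≈x⇒y′ : ∀ x y → (x ∧ y) ′ ≈ x ⇒ y ′
  [x∧y]′≈x⇒y′ x y = ″-involutive _

  ∧-cross-∨ : ∀ x y z → (x ∨ y) ∧ z ≈ z ∧ x ∨ y ∧ z
  ∧-cross-∨ x y z = begin
    (x ∨ y) ∧ z                          ≈⟨ ∧-cong (x∨y≈x′⇒y x y) refl ⟩
    ((x ′ ⇒ y) ⇒ z ′) ′                  ≈⟨ ′-cong (⇒-law (x ′) y (z ′)) ⟩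
    ((z ′ ′ ⇒ x ′) ⇒ (y ⇒ z ′) ′) ′ ′    ≈⟨ ″-involutive _ ⟩
    (z ′ ′ ⇒ x ′) ⇒ y ∧ z                ≈⟨ ∙-congʳ (∙-congʳ (″-involutive z)) ⟩
    (z ⇒ x ′) ⇒ y ∧ z                    ≈⟨ ∙-congʳ ([x∧y]′≈x⇒y′ z x) ⟨
    (z ∧ x) ′ ⇒ y ∧ z                    ≈⟨ x∨y≈x′⇒y (z ∧ x) (y ∧ z) ⟨
    z ∧ x ∨ y ∧ z                        ∎

  ∨-cross-∧ : ∀ x y z → (x ∧ y) ∨ z ≈ (z ∨ x) ∧ (y ∨ z)
  ∨-cross-∧ x y z = begin
    (x ∧ y) ∨ z                        ≈⟨ x∨y≈x′⇒y (x ∧ y) z ⟩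
    (x ∧ y) ′ ⇒ z                      ≈⟨ ∙-congʳ ([x∧y]′≈x⇒y′ x y) ⟩
    -- The right side of the law is a meet by definition.
    (x ⇒ y ′) ⇒ z                      ≈⟨ ⇒-law x (y ′) z ⟩
    (z ′ ⇒ x) ∧ (y ′ ⇒ z)              ≈⟨ ∧-cong (x∨y≈x′⇒y z x) (x∨y≈x′⇒y y z) ⟨
    (z ∨ x) ∧ (y ∨ z)                  ∎

  crossDistributive : CrossDistributive c ℓ
  crossDistributive = record
    { _∧_         = _∧_
    ; _∨_         = _∨_
    ; ⊤           = 0# ′
    ; ⊥           = 0#
    ; ∧-isMagma   = record { isEquivalence = isEquivalence ; ∙-cong = ∧-cong }
    ; ∨-isMagma   = record
      { isEquivalence = isEquivalence
      ; ∙-cong        = λ x≈y u≈v → ′-cong (∧-cong (′-cong x≈y) (′-cong u≈v))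
      }
    ; ∧-identityʳ = λ x → trans (′-cong (∙-congˡ 0″≈0)) (″-involutive x)
    ; ∨-identityʳ = λ x → trans (x∨y≈x′⇒y x 0#) (″-involutive x)
    ; ∧-cross-∨   = ∧-cross-∨
    ; ∨-cross-∧   = ∨-cross-∧
    }

-- Return from the quotient to the original equality.

theorem1p4 : ∀ {c ℓ} (A : ImplicationZroupoid c ℓ) → BirkhoffIdentity (mj A)
theorem1p4 A x y = begin
  x ∧ (x ∨ y)          ≈⟨ [x⇒y]‴≈[x⇒y]′ x ((x ∨ y) ′) ⟨
  (x ∧ (x ∨ y)) ′ ′    ≈⟨ Birkhoff.birkhoff (Involutive.crossDistributive /~ x″~x) x y ⟩
  -- A join is a doubly primed implication, hence the prime of an implication into `0#`.
  (x ∨ (x ∧ y)) ′ ′    ≈⟨ [x⇒y]‴≈[x⇒y]′ (x ′ ⇒ ((x ∧ y) ′) ′) 0# ⟩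
  x ∨ (x ∧ y)          ∎
  where
  open ImplicationZroupoid A
  open DoublePrime A
  open SetoidReasoning setoid
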